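{- Let $\Pi$ be the cobweb poset designated by a sequence $\{F_n\}_{n\ge 0}$ of natural numbers with $F_0=1$ (or exceptionally $F_0=0$). Let $k,n\in\mathbb{N}_0$ and $s\in\mathbb{N}$. Then, as functions of the type $(k,n)$: \begin{enumerate} \item $\zeta(k,n)=1$ if $k\le n$, and $\zeta(k,n)=0$ if $k>n$; \item $\zeta^2(k,n)=\left(\sum_{i=k+1}^{n-1}F_i\right)+2$ if $k\le n$, and $\zeta^2(k,n)=0$ if $k>n$; \item $\eta(k,n)=1$ if $k<n$, and $\eta(k,n)=0$ if $k\ge n$; \item $\eta^2(k,n)=\sum_{i=k+1}^{n-1}F_i$ if $k\le n$, and $\eta^2(k,n)=0$ if $k>n$; \item $\eta^s(k,n)=\sum_{k<i_1<\dots<i_{s-1}<n}F_{i_1}F_{i_2}\cdots F_{i_{s-1}}$ if $k\le n$, and $\eta^s(k,n)=0$ if $k>n$; \item $\mathcal{C}(k,n)=1$ if $k=n$, $\mathcal{C}(k,n)=-1$ if $k<n$, and $\mathcal{C}(k,n)=0$ if $k>n$; \item $\chi(k,n)=\delta(k+1,n)$; \item $\chi^s(k,n)=\delta(k+s,n)\cdot F_{k+1}F_{k+2}\cdots F_{n-1}$; \item $\mu(k,n)=(-1)^{n-k}\prod_{i=k+1}^{n-1}(F_i-1)$ if $k\le n$, and $\mu(k,n)=0$ if $k>n$. \end{enumerate}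
   Context: $\mathbb{N}_0=\mathbb{N}\cup\{0\}$. Cobweb poset: for $s\in\mathbb{N}_0$ let $\Phi_s=\{\langle j,s\rangle : 1\le j\le F_s\}$ (in the exceptional case $F_0=0$, the level $\Phi_0$ is a one-element set consisting of an empty root). Then $\Pi=(V,\le)$ with $V=\bigcup_{s\ge 0}\Phi_s$ and, for $x=\langle s,t\rangle$, $y=\langle u,v\rangle$: $x\le y$ iff $t<v$ or ($t=v$ and $s=u$). The rank function is $r(x)=s$ for $x\in\Phi_s$. For $x\le y$ the segment is $[x,y]=\{z\in\Pi: x\le z\le y\}$; $S(\Pi)$ is the set of all segments. $I(\Pi)$ is the incidence algebra of $\Pi$ over an associative ring with identity (functions $f(x,y)$ vanishing unless $x\le y$, with product $(f\ast g)(x,y)=\sum_{x\le z\le y}f(x,z)g(z,y)$ and identity the Kronecker delta $\delta(x,y)$); powers are taken with respect to $\ast$. For $k\le n$, $(k,n)=\{[x,y]\in S(\Pi): r(x)=k,\ r(y)=n\}$, and $(k,n)=\emptyset$ for $k>n$. For each of the functions $f$ below and their powers, $f(k,n)$ denotes the common value $f(x,y)$ for $[x,y]\in(k,n)$, and is $0$ when $k>n$. The functions are: $\zeta(x,y)=1$ if $x\le y$ and $0$ otherwise; $\mu=\zeta^{ -1}$ (the Möbius function); $\eta=\zeta-\delta$, so $\eta(x,y)=1$ if $x<y$ and $0$ otherwise; $\mathcal{C}=\delta-\eta$; and $\chi(x,y)=\delta(r(x)+1,r(y))$, i.e. $1$ if $y$ covers $x$ and $0$ otherwise. On integers, $\delta(a,b)$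 is the Kronecker delta. Empty sums are $0$ and empty products are $1$.
   Formalization: In item 2 the printed formula is proved for k<n only; at k=n it would give 2, but ζ²(x,x)=1, so the value 1 is stated and proved there. In item 5 with s=1 the chain condition is read as k<n, giving 0 at k=n as in item 3. -}

module Defs where

open import Level using (Level; _⊔_)
open import Algebra.Bundles using (Ring)
open import Algebra.Bundles.Raw using (RawRing)
open import Data.Bool.Base using (if_then_else_)
open import Data.Fin.Base using (Fin; toℕ)
open import Data.Fin.Properties using () renaming (_≟_ to _≟ᶠ_)
open import Data.List.Base
  using (List; []; _∷_; map; foldr; filter; concatMap; allFin; upTo; applyUpTo)
open import Data.List.Membership.Propositional using (_∈_; lose)
open import Data.List.Membership.Propositional.Properties
  using (∈-filter⁺; ∈-filter⁻; ∈-concatMap⁺; ∈-map⁺; ∈-allFin; ∈-upTo⁺)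
open import Data.List.Relation.Unary.Any using (here)
open import Data.Nat.Base as ℕ using (ℕ; zero; suc; _+_; _∸_; _<_; _≤_; _≥_; _>_; s≤s)
open import Data.Nat.Properties
  using (_≟_; _<?_; <-trans; <⇒≤; ≤-refl; n<1+n; +-comm)
open import Data.Product.Base using (Σ; _×_; _,_; proj₁; proj₂)
open import Data.Product.Properties using (≡-dec)
open import Data.Sum.Base using (_⊎_; inj₁; inj₂)
open import Relation.Binary.Definitions using (Decidable; DecidableEquality; Transitive)
open import Relation.Binary.PropositionalEquality
  using (_≡_; refl; trans; subst)
open import Relation.Nullary using (¬_; Dec; yes; no; does; contradiction)
open import Relation.Nullary.Decidable using (_⊎-dec_; _×-dec_)
import Algebra.Definitions
import Algebra.Definitions.RawSemiring as RawSemiringDefs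

record Designating (F : ℕ → ℕ) : Set where
  field
    root     : F 0 ≡ 1 ⊎ F 0 ≡ 0
    positive : ∀ n → n ≥ 1 → F n ≥ 1

-- The integers i with k < i < n, i.e. the index range i = k+1, …, n−1.
between : ℕ → ℕ → List ℕ
between k n = applyUpTo (suc k +_) (n ∸ suc k)

-- The lists i₁, …, iₘ with k < i₁ < ⋯ < iₘ < n.  For m = 0 the condition
-- reads k < n, so there is one (empty) list if k < n and none otherwise.
chains : ℕ → ℕ → ℕ → List (List ℕ)
chains zero    k n = if does (k <? n) then [] ∷ [] else []
chains (suc m) k n = concatMap (λ i → map (i ∷_) (chains m i n)) (between k n)

module Cobweb (F : ℕ → ℕ) where

  -- ∣Φ s∣ is F s, except that Φ 0 is a singleton also when F 0 = 0.
  ∣Φ_∣ : ℕ → ℕ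
  ∣Φ zero  ∣ = F 0 ℕ.⊔ 1
  ∣Φ suc s ∣ = F (suc s)

  -- (s , j) is the vertex ⟨ j + 1 , s ⟩: positions within a level count from 0.
  V : Set
  V = Σ ℕ (λ s → Fin ∣Φ s ∣)

  r : V → ℕ
  r = proj₁

  infix 4 _≼_ _≼?_ _≟ⱽ_

  _≼_ : V → V → Set
  (t , s) ≼ (v , u) = t < v ⊎ (t ≡ v × toℕ s ≡ toℕ u)

  _≼?_ : Decidable _≼_
  (t , s) ≼? (v , u) = (t <? v) ⊎-dec ((t ≟ v) ×-dec (toℕ s ≟ toℕ u))

  _≟ⱽ_ : DecidableEquality V
  _≟ⱽ_ = ≡-dec _≟_ _≟ᶠ_

  ≼-reflexive : ∀ {x y} → x ≡ y → x ≼ y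
  ≼-reflexive refl = inj₂ (refl , refl)

  ≼-trans : Transitive _≼_
  ≼-trans (inj₁ p)          (inj₁ q)          = inj₁ (<-trans p q)
  ≼-trans (inj₁ p)          (inj₂ (refl , _)) = inj₁ p
  ≼-trans (inj₂ (refl , _)) (inj₁ q)          = inj₁ q
  ≼-trans (inj₂ (refl , p)) (inj₂ (refl , q)) = inj₂ (refl , trans p q)

  ≼⇒r≤r : ∀ {x y} → x ≼ y → r x ≤ r y
  ≼⇒r≤r (inj₁ p)          = <⇒≤ p
  ≼⇒r≤r (inj₂ (refl , _)) = ≤-refl

  level : ℕ → List V
  level s = map (s ,_) (allFin ∣Φ s ∣)

  vertices≤ : ℕ → List V
  vertices≤ n = concatMap level (upTo (suc n))

  segment : V → V → List V
  segment x y = filter (λ z → (x ≼? z) ×-dec (z ≼? y)) (vertices≤ (r y))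

  ∈-segment⁻ : ∀ {x y z} → z ∈ segment x y → x ≼ z × z ≼ y
  ∈-segment⁻ {x} {y} p =
    proj₂ (∈-filter⁻ (λ z → (x ≼? z) ×-dec (z ≼? y)) {xs = vertices≤ (r y)} p)

  ∈-segment⁺ : ∀ {x y z} → x ≼ z → z ≼ y → z ∈ segment x y
  ∈-segment⁺ {x} {y} {s , j} p q =
    ∈-filter⁺ (λ z → (x ≼? z) ×-dec (z ≼? y))
      (∈-concatMap⁺ level
        (lose (∈-upTo⁺ (s≤s (≼⇒r≤r {s , j} {y} q)))
              (∈-map⁺ (s ,_) (∈-allFin j))))
      (p , q)

module Incidence {c ℓ : Level} (F : ℕ → ℕ) (R : Ring c ℓ) where

  open Cobweb F public
  open Ring R public using (0#; 1#; _*_; -_; _-_)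
  open Ring R
    using (Carrier; _≈_; rawRing)
    renaming (_+_ to _+ᴿ_; refl to ≈-refl; trans to ≈-trans)
  open import Algebra.Properties.Ring R using (-0#≈0#)

  ∑ : {A : Set} → List A → (A → Carrier) → Carrier
  ∑ xs g = foldr _+ᴿ_ 0# (map g xs)

  ∏ : {A : Set} → List A → (A → Carrier) → Carrier
  ∏ xs g = foldr _*_ 1# (map g xs)

  infixr 8 _^ᴿ_
  _^ᴿ_ : Carrier → ℕ → Carrier
  _^ᴿ_ = RawSemiringDefs._^_ (RawRing.rawSemiring rawRing)

  ι : ℕ → Carrier
  ι m = RawSemiringDefs._×_ (RawRing.rawSemiring rawRing) m 1#

  𝟙 : {P : Set} → Dec P → Carrier
  𝟙 P? = if does P? then 1# else 0#

  𝟙-false : {P : Set} (P? : Dec P) → ¬ P → 𝟙 P? ≈ 0#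
  𝟙-false (yes p) ¬p = contradiction p ¬p
  𝟙-false (no _)  _  = ≈-refl

  δ : ℕ → ℕ → Carrier
  δ a b = 𝟙 (a ≟ b)

  record I : Set (c ⊔ ℓ) where
    field
      ⟦_⟧      : V → V → Carrier
      vanishes : ∀ {x y} → ¬ x ≼ y → ⟦_⟧ x y ≈ 0#
  open I public

  infix  4 _≋_
  infixl 6 _⊕_ _⊖_
  infixl 7 _∗_

  _≋_ : I → I → Set ℓ
  f ≋ g = ∀ x y → ⟦ f ⟧ x y ≈ ⟦ g ⟧ x y

  segment-empty : ∀ {x y} → ¬ x ≼ y → segment x y ≡ []
  segment-empty {x} {y} x⋠y = empty (segment x y) λ {z} z∈ →
    let p , q = ∈-segment⁻ {x} {y} z∈ in x⋠y (≼-trans {x} {z} {y} p q)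
    where
    empty : (zs : List V) → (∀ {z} → ¬ z ∈ zs) → zs ≡ []
    empty []       _    = refl
    empty (z ∷ zs) none = contradiction (here refl) none

  _∗_ : I → I → I
  ⟦ f ∗ g ⟧ x y = ∑ (segment x y) λ z → ⟦ f ⟧ x z * ⟦ g ⟧ z y
  vanishes (f ∗ g) {x} {y} x⋠y rewrite segment-empty {x} {y} x⋠y = ≈-refl

  𝟎 : I
  ⟦ 𝟎 ⟧ x y = 0#
  vanishes 𝟎 _ = ≈-refl

  𝜹 : I
  ⟦ 𝜹 ⟧ x y = 𝟙 (x ≟ⱽ y)
  vanishes 𝜹 {x} {y} x⋠y = 𝟙-false (x ≟ⱽ y) λ x≡y → x⋠y (≼-reflexive x≡y)

  _⊕_ : I → I → I
  ⟦ f ⊕ g ⟧ x y = ⟦ f ⟧ x y +ᴿ ⟦ g ⟧ x y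
  vanishes (f ⊕ g) p =
    ≈-trans (Ring.+-cong R (vanishes f p) (vanishes g p)) (Ring.+-identityˡ R 0#)

  ⊝_ : I → I
  ⟦ ⊝ f ⟧ x y = - ⟦ f ⟧ x y
  vanishes (⊝ f) p = ≈-trans (Ring.-‿cong R (vanishes f p)) -0#≈0#

  _⊖_ : I → I → I
  f ⊖ g = f ⊕ (⊝ g)

  incidenceAlgebra : RawRing (c ⊔ ℓ) ℓ
  incidenceAlgebra = record
    { Carrier = I
    ; _≈_     = _≋_
    ; _+_     = _⊕_
    ; _*_     = _∗_
    ; -_      = ⊝_
    ; 0#      = 𝟎
    ; 1#      = 𝜹
    }

  open RawSemiringDefs (RawRing.rawSemiring incidenceAlgebra) public using (_^_)
  open Algebra.Definitions _≋_ public using (Invertible)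

  ζ : I
  ⟦ ζ ⟧ x y = 𝟙 (x ≼? y)
  vanishes ζ {x} {y} x⋠y = 𝟙-false (x ≼? y) x⋠y

  η : I
  η = ζ ⊖ 𝜹

  𝒞 : I
  𝒞 = 𝜹 ⊖ η

  χ : I
  ⟦ χ ⟧ x y = δ (r x + 1) (r y)
  vanishes χ {x} {y} x⋠y = 𝟙-false (r x + 1 ≟ r y) λ r+1≡r →
    x⋠y (inj₁ (subst (r x <_) (trans (+-comm 1 (r x)) r+1≡r) (n<1+n (r x))))

  -- "f(k,n) is defined and equals v": v is the common value of f on all
  -- segments [x,y] with r x = k and r y = n, and f(k,n) is 0 by convention
  -- for k > n, where there are no such segments.
  infix 4 _⟨_∣_⟩≈_
  _⟨_∣_⟩≈_ : I → ℕ → ℕ → Carrier → Set ℓ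
  f ⟨ k ∣ n ⟩≈ v =
    (∀ x y → x ≼ y → r x ≡ k → r y ≡ n → ⟦ f ⟧ x y ≈ v) × (k > n → v ≈ 0#)

{-# OPTIONS --safe #-}

-- On a cobweb poset a function that only depends on ranks is a function A of
-- pairs (k , n), and for k < n convolution reads
--   (A ∗ B)(k,n) = A(k,k) B(k,n) + ∑_{k<i<n} Fᵢ A(k,i) B(i,n) + A(k,n) B(n,n).
-- Every power formula is this identity iterated.  For the Möbius function the
-- relations M(k,n+1) = − M(k,n) (Fₙ − 1) and M(k,n) = − (Fₖ₊₁ − 1) M(k+1,n)
-- make both M ∗ ζ and ζ ∗ M telescope to δ, and an inverse of ζ is unique since
-- f ∗ ζ determines f by recursion on the rank of the right endpoint.
module Submission where

open import Defs
open import Level using (Level)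
open import Algebra.Bundles using (Ring)
open import Data.Bool.Base using (if_then_else_)
open import Data.Fin.Properties using (toℕ-injective)
open import Data.List.Base
  using (List; []; _∷_; _++_; _∷ʳ_; map; filter; concatMap; length; allFin; upTo; applyUpTo)
open import Data.List.Membership.Propositional using (_∈_)
open import Data.List.Membership.Propositional.Properties
  using (∈-applyUpTo⁻; ∈-upTo⁻; ∈-map⁺; ∈-map⁻; ∈-allFin)
open import Data.List.Properties
  using (map-++; map-cong; length-map; length-tabulate; upTo-∷ʳ; applyUpTo-∷ʳ; ++-assoc)
open import Data.List.Relation.Unary.All using () renaming (lookup to All-lookup)
open import Data.List.Relation.Unary.AllPairs using (_∷_)
open import Data.List.Relation.Unary.Any using (here; there)
open import Data.List.Relation.Unary.Unique.Propositional using (Unique)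
open import Data.List.Relation.Unary.Unique.Propositional.Properties
  using (map⁺; allFin⁺)
open import Data.Nat.ListAction using (sum; product)
open import Data.Nat.ListAction.Properties using (sum-++)
open import Data.Nat.Base as ℕ
  using (ℕ; zero; suc; _+_; _∸_; _<_; _≤_; _≥_; _>_; s≤s; _≤′_; ≤′-reflexive; ≤′-step;
         _≤‴_; ≤‴-reflexive; ≤‴-step)
open import Data.Nat.Induction using (Acc; acc; <-wellFounded)
open import Data.Nat.Properties
  using (_≟_; _<?_; suc-injective; +-suc; +-comm; +-∸-assoc; +-monoʳ-<; *-distribˡ-+; *-zeroʳ;
         m+1+n≢m; m+[n∸m]≡n; m+n∸n≡m; m≤n⇒m∸n≡0; n∸n≡0; m≤m+n; n≤1+n; n<1+n; m≤n⇒m<n∨m≡n;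
         ≤-refl; ≤-reflexive; ≤-trans; <-irrefl; <-trans; <-cmp; <⇒≤; <⇒≢; <⇒≱; <⇒≯; ≤⇒≯;
         ≮⇒≥; ≤⇒≤′; ≤′⇒≤; ≤⇒≤‴; ≤‴⇒≤)
import Data.Nat.Properties as ℕₚ
open import Data.Product.Base using (_×_; _,_; proj₁; proj₂)
open import Data.Sum.Base using (inj₁; inj₂)
open import Function.Base using (_∘_; id; case_of_)
open import Relation.Binary.Definitions using (tri<; tri≈; tri>)
open import Relation.Binary.PropositionalEquality
  using (_≡_; _≢_; refl; sym; trans; cong; cong₂; subst; module ≡-Reasoning)
open import Relation.Nullary using (¬_; Dec; yes; no; does; contradiction)
open import Relation.Nullary.Decidable using (_×-dec_; dec-true; dec-false)

-- Index ranges and their decompositions.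

between-[] : ∀ {k n} → n ≤ suc k → between k n ≡ []
between-[] n≤1+k rewrite m≤n⇒m∸n≡0 n≤1+k = refl

applyUpTo-cong : ∀ {A : Set} {f g : ℕ → A} → (∀ i → f i ≡ g i) →
  ∀ n → applyUpTo f n ≡ applyUpTo g n
applyUpTo-cong eq zero    = refl
applyUpTo-cong eq (suc n) = cong₂ _∷_ (eq 0) (applyUpTo-cong (eq ∘ suc) n)

between-∷ : ∀ {k n} → suc k < n → between k n ≡ suc k ∷ between (suc k) n
between-∷ {k} {n} 1+k<n rewrite +-∸-assoc 1 1+k<n =
  cong₂ _∷_ (cong suc (ℕₚ.+-identityʳ k))
    (applyUpTo-cong (λ i → cong suc (+-suc k i)) (n ∸ suc (suc k)))

between-∷ʳ : ∀ {k n} → k < n → between k (suc n) ≡ between k n ∷ʳ n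
between-∷ʳ {k} {n} k<n rewrite +-∸-assoc 1 k<n = begin
  applyUpTo (suc k +_) (suc (n ∸ suc k))     ≡⟨ applyUpTo-∷ʳ (suc k +_) (n ∸ suc k) ⟨
  between k n ∷ʳ (suc k + (n ∸ suc k))       ≡⟨ cong (between k n ∷ʳ_) (m+[n∸m]≡n k<n) ⟩
  between k n ∷ʳ n                           ∎
  where open ≡-Reasoning

∈-between⁻ : ∀ {k n i} → i ∈ between k n → k < i × i < n
∈-between⁻ {k} {n} i∈ with j , j<d , refl ← ∈-applyUpTo⁻ (suc k +_) i∈ =
  s≤s (m≤m+n k j) , subst (suc k + j <_) (m+[n∸m]≡n 1+k≤n) (+-monoʳ-< (suc k) j<d)
  where
  -- Truncated subtraction hides this bound: were `n ≤ k`, the range would have length 0 and could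
  -- not contain `i`.
  1+k≤n : suc k ≤ n
  1+k≤n = case <-cmp k n of λ where
    (tri< k<n _ _)  → k<n
    (tri≈ _ refl _) → contradiction (subst (j <_) (m≤n⇒m∸n≡0 (n≤1+n n)) j<d) λ ()
    (tri> _ _ n<k)  →
      contradiction (subst (j <_) (m≤n⇒m∸n≡0 (≤-trans (<⇒≤ n<k) (n≤1+n k))) j<d) λ ()

-- Separates the ranks that a segment starting at rank `k` cannot meet, its lowest rank, and the
-- rest. The induction runs on `≤′` because both `upTo` and `between` are extended at the upper end.
upTo-split : ∀ {k n} → k < n → upTo n ≡ upTo k ++ k ∷ between k n
upTo-split {k} k<n = go (≤⇒≤′ k<n)
  where
  open ≡-Reasoning
  go : ∀ {n} → suc k ≤′ n → upTo n ≡ upTo k ++ k ∷ between k n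
  go (≤′-reflexive refl) = begin
    upTo (suc k)                         ≡⟨ upTo-∷ʳ k ⟨
    upTo k ++ k ∷ []
      ≡⟨ cong (λ zs → upTo k ++ k ∷ zs) (between-[] {k} ≤-refl) ⟨
    upTo k ++ k ∷ between k (suc k)      ∎
  go {suc n} (≤′-step k<′n) = begin
    upTo (suc n)                         ≡⟨ upTo-∷ʳ n ⟨
    upTo n ∷ʳ n                          ≡⟨ cong (_∷ʳ n) (go k<′n) ⟩
    (upTo k ++ k ∷ between k n) ∷ʳ n     ≡⟨ ++-assoc (upTo k) _ _ ⟩
    upTo k ++ k ∷ (between k n ∷ʳ n)
      ≡⟨ cong (λ zs → upTo k ++ k ∷ zs) (between-∷ʳ (≤′⇒≤ k<′n)) ⟨
    upTo k ++ k ∷ between k (suc n)      ∎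

sum-map-concatMap : ∀ {A B : Set} (w : B → ℕ) (c : A → List B) as →
  sum (map w (concatMap c as)) ≡ sum (map (λ a → sum (map w (c a))) as)
sum-map-concatMap w c []       = refl
sum-map-concatMap w c (a ∷ as) = begin
  sum (map w (c a ++ concatMap c as))                  ≡⟨ cong sum (map-++ w (c a) _) ⟩
  sum (map w (c a) ++ map w (concatMap c as))          ≡⟨ sum-++ (map w (c a)) _ ⟩
  sum (map w (c a)) + sum (map w (concatMap c as))
    ≡⟨ cong (sum (map w (c a)) +_) (sum-map-concatMap w c as) ⟩
  sum (map w (c a)) + sum (map (λ a → sum (map w (c a))) as) ∎
  where open ≡-Reasoning

-- Weighted counts of chains of ranks.

module _ (F : ℕ → ℕ) where

  -- For `m ≥ 1` this is the elementary symmetric polynomial of degree `m` in the `F i` with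
  -- `k < i < n`. For `m = 0` it is the indicator of `k < n` instead of the constant 1, so that
  -- `chainWeight m` matches `η ^ suc m` from the start.
  chainWeight : ℕ → ℕ → ℕ → ℕ
  chainWeight m k n = sum (map (λ is → product (map F is)) (chains m k n))

  chainWeight-0-< : ∀ {k n} → k < n → chainWeight 0 k n ≡ 1
  chainWeight-0-< {k} {n} k<n rewrite dec-true (k <? n) k<n = refl

  chainWeight-0-≥ : ∀ {k n} → k ≥ n → chainWeight 0 k n ≡ 0
  chainWeight-0-≥ {k} {n} k≥n rewrite dec-false (k <? n) (≤⇒≯ k≥n) = refl

  chainWeight-diag : ∀ m k → chainWeight m k k ≡ 0
  chainWeight-diag zero    k = chainWeight-0-≥ {k} ≤-refl
  chainWeight-diag (suc m) k rewrite between-[] {k} (n≤1+n k) = refl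

  sum-product-∷ : ∀ i iss → sum (map (λ is → product (map F is)) (map (i ∷_) iss)) ≡
    F i ℕ.* sum (map (λ is → product (map F is)) iss)
  sum-product-∷ i []         = sym (*-zeroʳ (F i))
  sum-product-∷ i (is ∷ iss) = trans
    (cong (F i ℕ.* product (map F is) +_) (sum-product-∷ i iss))
    (sym (*-distribˡ-+ (F i) _ _))

  -- Grouping the chains by their least element `i` factors out `F i`. The resulting recursion is
  -- the one that left multiplication by `η` obeys.
  chainWeight-suc : ∀ m k n →
    chainWeight (suc m) k n ≡ sum (map (λ i → F i ℕ.* chainWeight m i n) (between k n))
  chainWeight-suc m k n = trans
    (sum-map-concatMap _ (λ i → map (i ∷_) (chains m i n)) (between k n))
    (cong sum (map-cong (λ i → sum-product-∷ i (chains m i n)) (between k n)))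

module RankFunctions {c ℓ : Level} (R : Ring c ℓ) (F : ℕ → ℕ) where

  open Incidence F R
  open Ring R
    using (Carrier; _≈_; setoid; +-cong; +-congˡ; +-congʳ; +-assoc; +-identityˡ;
           +-identityʳ; *-cong; *-congˡ; *-congʳ; *-assoc; *-identityˡ; *-identityʳ;
           zeroˡ; zeroʳ; distribʳ; -‿cong; -‿inverseˡ; -‿inverseʳ; semiring)
    renaming (_+_ to _+ᴿ_; refl to ≈-refl; sym to ≈-sym; trans to ≈-trans;
              reflexive to ≈-reflexive; +-comm to +ᴿ-comm)
  open import Algebra.Properties.Ring R
    using (-1*x≈-x; -‿distribˡ-*; -‿distribʳ-*; -0#≈0#; +-cancelˡ; -‿involutive;
           x[y-z]≈xy-xz; [y-z]x≈yx-zx)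
  open import Algebra.Properties.Semiring.Mult semiring
    using (×-homo-+; ×1-homo-*; ×-comm-*; ×-assoc-*; ×-homo-1)
  open import Relation.Binary.Reasoning.Setoid setoid

  private variable A B : Set

  -- Finite sums in a ring, over lists and over levels.

  ∑-cong : ∀ (xs : List A) {g h} → (∀ {z} → z ∈ xs → g z ≈ h z) → ∑ xs g ≈ ∑ xs h
  ∑-cong []       eq = ≈-refl
  ∑-cong (x ∷ xs) eq = +-cong (eq (here refl)) (∑-cong xs (eq ∘ there))

  ∑-++ : ∀ (xs ys : List A) g → ∑ (xs ++ ys) g ≈ ∑ xs g +ᴿ ∑ ys g
  ∑-++ []       ys g = ≈-sym (+-identityˡ _)
  ∑-++ (x ∷ xs) ys g = ≈-trans (+-congˡ (∑-++ xs ys g)) (≈-sym (+-assoc _ _ _))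

  ∑-concatMap : ∀ (c : A → List B) xs g → ∑ (concatMap c xs) g ≈ ∑ xs (λ x → ∑ (c x) g)
  ∑-concatMap c []       g = ≈-refl
  ∑-concatMap c (x ∷ xs) g = ≈-trans (∑-++ (c x) _ g) (+-congˡ (∑-concatMap c xs g))

  ∑-zero : ∀ (xs : List A) {g} → (∀ {z} → z ∈ xs → g z ≈ 0#) → ∑ xs g ≈ 0#
  ∑-zero []       eq = ≈-refl
  ∑-zero (x ∷ xs) eq =
    ≈-trans (+-cong (eq (here refl)) (∑-zero xs (eq ∘ there))) (+-identityˡ 0#)

  ∑-single : ∀ {xs : List A} {x} g → Unique xs → x ∈ xs →
    (∀ {z} → z ≢ x → g z ≈ 0#) → ∑ xs g ≈ g x
  ∑-single {xs = x ∷ xs} g (x∉ ∷ _) (here refl) zeros =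
    ≈-trans (+-congˡ (∑-zero xs λ z∈ → zeros (All-lookup x∉ z∈ ∘ sym))) (+-identityʳ _)
  ∑-single g (y∉ ∷ u) (there x∈) zeros =
    ≈-trans (+-cong (zeros (All-lookup y∉ x∈)) (∑-single g u x∈ zeros)) (+-identityˡ _)

  -- Multiplication in `R` may fail to commute, but natural multiples of `1#` are central; this lets
  -- level sizes move past values of incidence functions.
  ι-*-central : ∀ m a → ι m * a ≈ a * ι m
  ι-*-central m a = begin
    ι m * a                  ≈⟨ ×-assoc-* m 1# a ⟩
    m · (1# * a)   ≈⟨ ×-congʳ m (≈-trans (*-identityˡ a) (≈-sym (*-identityʳ a))) ⟩
    m · (a * 1#)   ≈⟨ ×-comm-* m a 1# ⟨
    a * ι m                  ∎
    where
    open import Algebra.Properties.Semiring.Mult semiring using (×-congʳ) renaming (_×_ to _·_)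

  ι-+ : ∀ m n → ι (m + n) ≈ ι m +ᴿ ι n
  ι-+ = ×-homo-+ 1#

  ι-* : ∀ m n → ι (m ℕ.* n) ≈ ι m * ι n
  ι-* = ×1-homo-*

  ι-1 : ι 1 ≈ 1#
  ι-1 = ×-homo-1 1#

  ι-sum : ∀ (w : A → ℕ) xs → ι (sum (map w xs)) ≈ ∑ xs (λ x → ι (w x))
  ι-sum w []       = ≈-refl
  ι-sum w (x ∷ xs) = ≈-trans (ι-+ (w x) _) (+-congˡ (ι-sum w xs))

  ∑-const : ∀ (xs : List A) {g a} → (∀ {z} → z ∈ xs → g z ≈ a) → ∑ xs g ≈ ι (length xs) * a
  ∑-const []       eq = ≈-sym (zeroˡ _)
  ∑-const (x ∷ xs) {g} {a} eq = begin
    g x +ᴿ ∑ xs g                       ≈⟨ +-cong (eq (here refl)) (∑-const xs (eq ∘ there)) ⟩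
    a +ᴿ ι (length xs) * a              ≈⟨ +-congʳ (*-identityˡ a) ⟨
    1# * a +ᴿ ι (length xs) * a         ≈⟨ distribʳ a _ _ ⟨
    (1# +ᴿ ι (length xs)) * a           ∎

  length-level : ∀ i → length (level i) ≡ ∣Φ i ∣
  length-level i =
    trans (length-map {B = V} (i ,_) (allFin ∣Φ i ∣)) (length-tabulate {n = ∣Φ i ∣} id)

  -- k < i excludes level 0, whose size is not F 0 when F 0 = 0.
  ∑-level : ∀ {k} i {g a} → k < i → (∀ j → g (i , j) ≈ a) → ∑ (level i) g ≈ ι (F i) * a
  ∑-level (suc i) {g} {a} _ eq = begin
    ∑ (level (suc i)) g               ≈⟨ ∑-const (level (suc i)) const-on-level ⟩
    ι (length (level (suc i))) * a
      ≈⟨ *-congʳ (≈-reflexive (cong ι (length-level (suc i)))) ⟩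
    ι (F (suc i)) * a                 ∎
    where
    const-on-level : ∀ {z} → z ∈ level (suc i) → g z ≈ a
    const-on-level z∈ with j , _ , refl ← ∈-map⁻ (suc i ,_) z∈ = eq j

  restrict : {P : Set} → Dec P → Carrier → Carrier
  restrict P? a = if does P? then a else 0#

  restrict-true : ∀ {P : Set} (P? : Dec P) {a} → P → restrict P? a ≈ a
  restrict-true (yes _) _ = ≈-refl
  restrict-true (no ¬p) p = contradiction p ¬p

  restrict-false : ∀ {P : Set} (P? : Dec P) {a} → ¬ P → restrict P? a ≈ 0#
  restrict-false (yes p) ¬p = contradiction p ¬p
  restrict-false (no _)  _  = ≈-refl

  -- Turning discarded terms into zeros keeps the vertex list intact, so that a segment sum can be
  -- regrouped by complete levels.
  ∑-filter : ∀ {P : A → Set} (P? : ∀ z → Dec (P z)) xs g →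
    ∑ (filter P? xs) g ≈ ∑ xs (λ z → restrict (P? z) (g z))
  ∑-filter P? []       g = ≈-refl
  ∑-filter P? (x ∷ xs) g with P? x
  ... | yes _ = +-congˡ (∑-filter P? xs g)
  ... | no  _ = ≈-trans (∑-filter P? xs g) (≈-sym (+-identityˡ _))

  -- Levels are antichains. Hence a segment meets the level of either endpoint in that endpoint
  -- alone.
  same-rank : ∀ {x y : V} → x ≼ y → r x ≡ r y → x ≡ y
  same-rank (inj₁ r<r)           r≡r = contradiction r≡r (<⇒≢ r<r)
  same-rank (inj₂ (refl , toℕ≡)) _   = cong (_ ,_) (toℕ-injective toℕ≡)

  -- Segment sums, level by level.

  module _ (x y : V) (h : V → Carrier) where

    private
      k = r x
      n = r y

      inSegment? : ∀ z → Dec (x ≼ z × z ≼ y)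
      inSegment? z = (x ≼? z) ×-dec (z ≼? y)

      h′ : V → Carrier
      h′ z = restrict (inSegment? z) (h z)

      levelSum : ℕ → Carrier
      levelSum i = ∑ (level i) h′

      -- On the level of `z`, lying in the segment amounts to being equal to `z`. After that
      -- replacement, made by `h″`, at most one term is nonzero, and it is counted once because a
      -- level lists no vertex twice.
      ∑-level-single : ∀ z → x ≼ z → z ≼ y → (∀ {w} → r w ≡ r z → w ≢ z → ¬ (x ≼ w × w ≼ y)) →
        levelSum (r z) ≈ h z
      ∑-level-single (i , j) x≼z z≼y alone = begin
        ∑ (map (i ,_) (allFin _)) h′    ≈⟨ ∑-cong (level i) (λ { w∈ → on-level w∈ }) ⟩
        ∑ (level i) h″                  ≈⟨ ∑-single h″ (map⁺ (λ { refl → refl }) (allFin⁺ _))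
                                             (∈-map⁺ (i ,_) (∈-allFin j)) off ⟩
        h″ (i , j)                      ≈⟨ restrict-true ((i , j) ≟ⱽ (i , j)) refl ⟩
        h (i , j)                       ∎
        where
        h″ : V → Carrier
        h″ w = restrict (w ≟ⱽ (i , j)) (h w)
        off : ∀ {w} → w ≢ (i , j) → h″ w ≈ 0#
        off {w} = restrict-false (w ≟ⱽ (i , j))
        on-level : ∀ {w} → w ∈ level i → h′ w ≈ h″ w
        on-level {w} w∈ with w ≟ⱽ (i , j)
        ... | yes refl = restrict-true (inSegment? (i , j)) (x≼z , z≼y)
        ... | no w≢z with _ , _ , refl ← ∈-map⁻ (i ,_) w∈ =
          restrict-false (inSegment? w) (alone refl w≢z)

      levelSum-below : ∀ {i} → i < k → levelSum i ≈ 0#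
      levelSum-below {i} i<k = ∑-zero (level i) λ { z∈ → off z∈ }
        where
        off : ∀ {z} → z ∈ level i → h′ z ≈ 0#
        off z∈ with j , _ , refl ← ∈-map⁻ (i ,_) z∈ =
          restrict-false (inSegment? (i , j)) λ (x≼z , _) →
            <⇒≱ i<k (≼⇒r≤r {x} {i , j} x≼z)

      levelSum-between : ∀ {i} → k < i → i < n → levelSum i ≈ ∑ (level i) h
      levelSum-between {i} k<i i<n = ∑-cong (level i) λ { z∈ → on z∈ }
        where
        on : ∀ {z} → z ∈ level i → h′ z ≈ h z
        on z∈ with j , _ , refl ← ∈-map⁻ (i ,_) z∈ =
          restrict-true (inSegment? (i , j)) (inj₁ k<i , inj₁ i<n)

      ∑-by-levels : ∑ (segment x y) h ≈ ∑ (upTo (suc n)) levelSum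
      ∑-by-levels = ≈-trans (∑-filter inSegment? (vertices≤ n) h)
                            (∑-concatMap level (upTo (suc n)) h′)

      levelSum-source : x ≼ y → levelSum k ≈ h x
      levelSum-source x≼y = ∑-level-single x (≼-reflexive {x} refl) x≼y
        λ {w} rw≡rx w≢x (x≼w , _) → w≢x (sym (same-rank {x} {w} x≼w (sym rw≡rx)))

      levelSum-target : x ≼ y → levelSum n ≈ h y
      levelSum-target x≼y = ∑-level-single y x≼y (≼-reflexive {y} refl)
        λ {w} rw≡ry w≢y (_ , w≼y) → w≢y (same-rank {w} {y} w≼y rw≡ry)

    ∑-segment-≡ : x ≼ y → k ≡ n → ∑ (segment x y) h ≈ h x
    ∑-segment-≡ x≼y k≡n = begin
      ∑ (segment x y) h                    ≈⟨ ∑-by-levels ⟩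
      ∑ (upTo (suc n)) levelSum            ≡⟨ cong (λ m → ∑ (upTo (suc m)) levelSum) (sym k≡n) ⟩
      ∑ (upTo (suc k)) levelSum            ≡⟨ cong (λ is → ∑ is levelSum) (sym (upTo-∷ʳ k)) ⟩
      ∑ (upTo k ∷ʳ k) levelSum             ≈⟨ ∑-++ (upTo k) (k ∷ []) levelSum ⟩
      ∑ (upTo k) levelSum +ᴿ (levelSum k +ᴿ 0#)
        ≈⟨ +-cong (∑-zero (upTo k) (levelSum-below ∘ ∈-upTo⁻)) (+-identityʳ _) ⟩
      0# +ᴿ levelSum k                     ≈⟨ +-identityˡ _ ⟩
      levelSum k                           ≈⟨ levelSum-source x≼y ⟩
      h x                                  ∎

    -- Levels `k` and `n` contribute only their endpoints, while every vertex of a level strictly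
    -- between is comparable to both, so such levels enter in full. `h` is arbitrary, because the
    -- uniqueness argument applies this to functions not yet known to depend on ranks only.
    ∑-segment-< : k < n →
      ∑ (segment x y) h ≈ h x +ᴿ (∑ (between k n) (λ i → ∑ (level i) h) +ᴿ h y)
    ∑-segment-< k<n = begin
      ∑ (segment x y) h                    ≈⟨ ∑-by-levels ⟩
      ∑ (upTo (suc n)) levelSum
        -- Splitting `upTo (suc n)` at `k` leaves rank `n` as the last entry of `between k (suc n)`,
        -- from which it is detached below.
        ≡⟨ cong (λ is → ∑ is levelSum) (upTo-split (<-trans k<n (n<1+n n))) ⟩
      ∑ (upTo k ++ k ∷ between k (suc n)) levelSum
        ≈⟨ ∑-++ (upTo k) (k ∷ between k (suc n)) levelSum ⟩
      ∑ (upTo k) levelSum +ᴿ (levelSum k +ᴿ ∑ (between k (suc n)) levelSum)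
        ≈⟨ +-cong (∑-zero (upTo k) (levelSum-below ∘ ∈-upTo⁻))
                  (+-cong (levelSum-source (inj₁ k<n))
                    (≈-reflexive (cong (λ is → ∑ is levelSum) (between-∷ʳ k<n)))) ⟩
      0# +ᴿ (h x +ᴿ ∑ (between k n ∷ʳ n) levelSum)   ≈⟨ +-identityˡ _ ⟩
      h x +ᴿ ∑ (between k n ∷ʳ n) levelSum
        ≈⟨ +-congˡ (∑-++ (between k n) (n ∷ []) levelSum) ⟩
      h x +ᴿ (∑ (between k n) levelSum +ᴿ (levelSum n +ᴿ 0#))
        ≈⟨ +-congˡ (+-cong (∑-cong (between k n) λ i∈ →
             let k<i , i<n = ∈-between⁻ i∈ in levelSum-between k<i i<n)
             (≈-trans (+-identityʳ _) (levelSum-target (inj₁ k<n)))) ⟩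
      h x +ᴿ (∑ (between k n) (λ i → ∑ (level i) h) +ᴿ h y) ∎

  -- Convolution of functions of the rank.

  infix 4 _∼_
  -- Only comparable pairs are constrained, so `a` is free at ranks `k > n`, and its diagonal
  -- describes only `x = y`. This permits simple choices such as the constant `1#` for `ζ`.
  _∼_ : I → (ℕ → ℕ → Carrier) → Set ℓ
  f ∼ a = ∀ x y → x ≼ y → ⟦ f ⟧ x y ≈ a (r x) (r y)

  -- Meant for `k < n`: at `k = n` the first and last terms would count the same vertex twice, hence
  -- the separate `∗-≡`.
  convolve : (ℕ → ℕ → Carrier) → (ℕ → ℕ → Carrier) → ℕ → ℕ → Carrier
  convolve a b k n =
    a k k * b k n +ᴿ (∑ (between k n) (λ i → ι (F i) * (a k i * b i n)) +ᴿ a k n * b n n)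

  ∗-< : ∀ {f g a b} → f ∼ a → g ∼ b → ∀ x y → r x < r y →
    ⟦ f ∗ g ⟧ x y ≈ convolve a b (r x) (r y)
  ∗-< {f} {g} {a} {b} f∼a g∼b x y k<n = begin
    ∑ (segment x y) (λ z → ⟦ f ⟧ x z * ⟦ g ⟧ z y)   ≈⟨ ∑-segment-< x y _ k<n ⟩
    ⟦ f ⟧ x x * ⟦ g ⟧ x y +ᴿ
      (∑ (between (r x) (r y)) (λ i → ∑ (level i) (λ z → ⟦ f ⟧ x z * ⟦ g ⟧ z y)) +ᴿ
       ⟦ f ⟧ x y * ⟦ g ⟧ y y)
      ≈⟨ +-cong (*-cong (f∼a x x (≼-reflexive {x} refl)) (g∼b x y (inj₁ k<n)))
           (+-cong (∑-cong (between (r x) (r y)) λ {i} i∈ →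
                      let k<i , i<n = ∈-between⁻ i∈ in
                      ∑-level i k<i λ j →
                        *-cong (f∼a x (i , j) (inj₁ k<i)) (g∼b (i , j) y (inj₁ i<n)))
                   (*-cong (f∼a x y (inj₁ k<n)) (g∼b y y (≼-reflexive {y} refl)))) ⟩
    convolve a b (r x) (r y) ∎

  ∗-≡ : ∀ {f g a b} → f ∼ a → g ∼ b → ∀ x y → x ≼ y → r x ≡ r y →
    ⟦ f ∗ g ⟧ x y ≈ a (r x) (r x) * b (r x) (r y)
  ∗-≡ f∼a g∼b x y x≼y k≡n = ≈-trans (∑-segment-≡ x y _ x≼y k≡n)
    (*-cong (f∼a x x (≼-reflexive {x} refl)) (g∼b x y x≼y))

  ∗-∼ : ∀ {f g a b c} → f ∼ a → g ∼ b →
    (∀ k → a k k * b k k ≈ c k k) → (∀ {k n} → k < n → convolve a b k n ≈ c k n) →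
    f ∗ g ∼ c
  ∗-∼ {f} {g} {a} {b} {c} f∼a g∼b diag off x y x≼y with m≤n⇒m<n∨m≡n (≼⇒r≤r {x} {y} x≼y)
  ... | inj₁ k<n = ≈-trans (∗-< {f} {g} f∼a g∼b x y k<n) (off k<n)
  ... | inj₂ k≡n = ≈-trans (∗-≡ {f} {g} f∼a g∼b x y x≼y k≡n)
    (subst (λ n → a (r x) (r x) * b (r x) n ≈ c (r x) n) k≡n (diag (r x)))

  ∼⇒≋ : ∀ {f g a} → f ∼ a → g ∼ a → f ≋ g
  ∼⇒≋ {f} {g} f∼a g∼a x y with x ≼? y
  ... | yes x≼y = ≈-trans (f∼a x y x≼y) (≈-sym (g∼a x y x≼y))
  ... | no  x⋠y = ≈-trans (vanishes f x⋠y) (≈-sym (vanishes g x⋠y))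

  ∼⇒⟨⟩ : ∀ {f a k n v} → f ∼ a → a k n ≈ v → (k > n → v ≈ 0#) → f ⟨ k ∣ n ⟩≈ v
  ∼⇒⟨⟩ f∼a eq v≈0 = (λ { x y x≼y refl refl → ≈-trans (f∼a x y x≼y) eq }) , v≈0

  ∼⇒⟨⟩-≤ : ∀ {f a k n v} → f ∼ a → k ≤ n → a k n ≈ v → f ⟨ k ∣ n ⟩≈ v
  ∼⇒⟨⟩-≤ {f} f∼a k≤n eq = ∼⇒⟨⟩ {f} f∼a eq λ k>n → contradiction k≤n (<⇒≱ k>n)

  ⟨⟩-> : ∀ f {k n} → k > n → f ⟨ k ∣ n ⟩≈ 0#
  ⟨⟩-> f k>n =
    (λ { x y x≼y refl refl → contradiction (≼⇒r≤r {x} {y} x≼y) (<⇒≱ k>n) }) , λ _ → ≈-refl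

  -- Rank descriptions of the basic functions.

  𝟙-true : ∀ {P : Set} (P? : Dec P) → P → 𝟙 P? ≈ 1#
  𝟙-true P? = restrict-true P?

  δ-≡ : ∀ {k n} → k ≡ n → δ k n ≈ 1#
  δ-≡ {k} {n} = 𝟙-true (k ≟ n)

  δ-≢ : ∀ {k n} → k ≢ n → δ k n ≈ 0#
  δ-≢ {k} {n} = 𝟙-false (k ≟ n)

  lt : ℕ → ℕ → Carrier
  lt k n = 𝟙 (k <? n)

  lt-< : ∀ {k n} → k < n → lt k n ≈ 1#
  lt-< {k} {n} = 𝟙-true (k <? n)

  lt-≥ : ∀ {k n} → k ≥ n → lt k n ≈ 0#
  lt-≥ {k} {n} k≥n = 𝟙-false (k <? n) λ k<n → <⇒≱ k<n k≥n

  x-0≈x : ∀ x → x - 0# ≈ x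
  x-0≈x x = ≈-trans (+-congˡ -0#≈0#) (+-identityʳ x)

  *-zero : ∀ {a b} → a ≈ 0# → a * b ≈ 0#
  *-zero a≈0 = ≈-trans (*-congʳ a≈0) (zeroˡ _)

  *-zero′ : ∀ {a b} → b ≈ 0# → a * b ≈ 0#
  *-zero′ b≈0 = ≈-trans (*-congˡ b≈0) (zeroʳ _)

  0+ : ∀ {a b c} → a ≈ 0# → b ≈ c → a +ᴿ b ≈ c
  0+ a≈0 b≈c = ≈-trans (+-cong a≈0 b≈c) (+-identityˡ _)

  +0 : ∀ {a b c} → a ≈ c → b ≈ 0# → a +ᴿ b ≈ c
  +0 a≈c b≈0 = ≈-trans (+-cong a≈c b≈0) (+-identityʳ _)

  1* : ∀ {a b c} → a ≈ 1# → b ≈ c → a * b ≈ c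
  1* a≈1 b≈c = ≈-trans (*-cong a≈1 b≈c) (*-identityˡ _)

  *1 : ∀ {a b c} → a ≈ c → b ≈ 1# → a * b ≈ c
  *1 a≈c b≈1 = ≈-trans (*-cong a≈c b≈1) (*-identityʳ _)

  𝜹∼δ : 𝜹 ∼ δ
  𝜹∼δ x y x≼y with x ≟ⱽ y
  ... | yes refl = ≈-sym (δ-≡ {r x} refl)
  ... | no  x≢y  = ≈-sym (δ-≢ λ k≡n → x≢y (same-rank {x} {y} x≼y k≡n))

  ζ∼1 : ζ ∼ λ _ _ → 1#
  ζ∼1 x y = 𝟙-true (x ≼? y)

  χ∼δ : χ ∼ λ k n → δ (k + 1) n
  χ∼δ x y _ = ≈-refl

  η∼lt : η ∼ lt
  η∼lt x y x≼y with m≤n⇒m<n∨m≡n (≼⇒r≤r {x} {y} x≼y)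
  ... | inj₁ k<n = begin
    ⟦ ζ ⟧ x y - ⟦ 𝜹 ⟧ x y
      ≈⟨ +-cong (ζ∼1 x y x≼y) (-‿cong (≈-trans (𝜹∼δ x y x≼y) (δ-≢ (<⇒≢ k<n)))) ⟩
    1# - 0#                    ≈⟨ x-0≈x 1# ⟩
    1#                         ≈⟨ lt-< k<n ⟨
    lt (r x) (r y)             ∎
  ... | inj₂ k≡n = begin
    ⟦ ζ ⟧ x y - ⟦ 𝜹 ⟧ x y
      ≈⟨ +-cong (ζ∼1 x y x≼y) (-‿cong (≈-trans (𝜹∼δ x y x≼y) (δ-≡ k≡n))) ⟩
    1# - 1#                    ≈⟨ -‿inverseʳ 1# ⟩
    0#                         ≈⟨ lt-≥ (≤-reflexive (sym k≡n)) ⟨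
    lt (r x) (r y)             ∎

  𝒞∼δ-lt : 𝒞 ∼ λ k n → δ k n - lt k n
  𝒞∼δ-lt x y x≼y = +-cong (𝜹∼δ x y x≼y) (-‿cong (η∼lt x y x≼y))

  -- Powers of `η`, `ζ` and `χ`.

  ∗-𝜹 : ∀ {f a} → f ∼ a → f ∗ 𝜹 ∼ a
  ∗-𝜹 {f} f∼a = ∗-∼ {f} {𝜹} f∼a 𝜹∼δ (λ k → *1 ≈-refl (δ-≡ {k} refl)) λ {k} {n} k<n →
    0+ (*-zero′ (δ-≢ (<⇒≢ k<n)))
       (0+ (∑-zero (between k n) λ i∈ →
              *-zero′ (*-zero′ (δ-≢ (<⇒≢ (proj₂ (∈-between⁻ i∈))))))
           (*1 ≈-refl (δ-≡ {n} refl)))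

  -- The outer terms of the convolution vanish, since both `η` and `chainWeight` are zero on the
  -- diagonal; the middle sum is `chainWeight-suc`.
  η^∼ : ∀ m → η ^ suc m ∼ λ k n → ι (chainWeight F m k n)
  -- `η ^ 1` unfolds to `η ∗ 𝜹`, not to `η`, so the base case needs the unit law.
  η^∼ zero x y x≼y = ≈-trans (∗-𝜹 {η} η∼lt x y x≼y) (lt≈ι (r x) (r y))
    where
    lt≈ι : ∀ k n → lt k n ≈ ι (chainWeight F 0 k n)
    lt≈ι k n with k <? n
    ... | yes k<n = ≈-trans (lt-< k<n)
      (≈-sym (≈-trans (≈-reflexive (cong ι (chainWeight-0-< F k<n))) ι-1))
    ... | no  k≮n = ≈-trans (lt-≥ (≮⇒≥ k≮n))
      (≈-sym (≈-reflexive (cong ι (chainWeight-0-≥ F (≮⇒≥ k≮n)))))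
  η^∼ (suc m) = ∗-∼ {η} {η ^ suc m} η∼lt (η^∼ m)
    (λ k → ≈-trans (*-zero (lt-≥ {k} ≤-refl))
                   (≈-sym (≈-reflexive (cong ι (chainWeight-diag F (suc m) k)))))
    λ {k} {n} k<n → 0+ (*-zero (lt-≥ {k} ≤-refl)) (+0
      (begin
        ∑ (between k n) (λ i → ι (F i) * (lt k i * ι (chainWeight F m i n)))
          ≈⟨ ∑-cong (between k n) (λ {i} i∈ → ≈-trans
               (*-congˡ (1* (lt-< (proj₁ (∈-between⁻ {k} {n} i∈))) ≈-refl))
               (≈-sym (ι-* (F i) (chainWeight F m i n)))) ⟩
        ∑ (between k n) (λ i → ι (F i ℕ.* chainWeight F m i n))
          ≈⟨ ι-sum (λ i → F i ℕ.* chainWeight F m i n) (between k n) ⟨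
        ι (sum (map (λ i → F i ℕ.* chainWeight F m i n) (between k n)))
          ≡⟨ cong ι (sym (chainWeight-suc F m k n)) ⟩
        ι (chainWeight F (suc m) k n) ∎)
      (*-zero′ (≈-reflexive (cong ι (chainWeight-diag F m n)))))

  -- The 2 comes from the two endpoints of the segment.
  convolve-1-1 : ∀ k n →
    convolve (λ _ _ → 1#) (λ _ _ → 1#) k n ≈ ι (sum (map F (between k n)) + 2)
  convolve-1-1 k n = begin
    1# * 1# +ᴿ (∑ ks (λ i → ι (F i) * (1# * 1#)) +ᴿ 1# * 1#)
      ≈⟨ +-cong 1*1≈1 (+-cong (∑-cong ks λ _ → *1 ≈-refl 1*1≈1) 1*1≈1) ⟩
    1# +ᴿ (∑ ks (λ i → ι (F i)) +ᴿ 1#)       ≈⟨ +-congˡ (+-congʳ (ι-sum F ks)) ⟨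
    1# +ᴿ (ι (sum (map F ks)) +ᴿ 1#)         ≈⟨ +-congˡ (+-congˡ ι-1) ⟨
    1# +ᴿ (ι (sum (map F ks)) +ᴿ ι 1)        ≈⟨ +-congˡ (ι-+ (sum (map F ks)) 1) ⟨
    ι (suc (sum (map F ks) + 1))             ≡⟨ cong ι (sym (+-suc (sum (map F ks)) 1)) ⟩
    ι (sum (map F ks) + 2)                   ∎
    where
    ks = between k n
    1*1≈1 = *-identityˡ 1#

  -- The left factor `χ` forces the intermediate vertex to rank `k + 1`. Only that term survives,
  -- with multiplicity `F (suc k)`, and it extends the product at its lower end.
  χ^∼ : ∀ m → χ ^ suc m ∼ λ k n → δ (k + suc m) n * ι (product (map F (between k n)))
  χ^∼ zero x y x≼y = ≈-trans (∗-𝜹 {χ} χ∼δ x y x≼y) (step (r x) (r y))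
    where
    step : ∀ k n → δ (k + 1) n ≈ δ (k + 1) n * ι (product (map F (between k n)))
    step k n with k + 1 ≟ n
    ... | no  k+1≢n = ≈-trans (δ-≢ k+1≢n) (≈-sym (*-zero (δ-≢ k+1≢n)))
    ... | yes refl  = ≈-sym (*1 ≈-refl (≈-trans
      (≈-reflexive (cong (λ is → ι (product (map F is)))
        (between-[] {k} (≤-reflexive (+-comm k 1))))) ι-1))
  χ^∼ (suc m) = ∗-∼ {χ} {χ ^ suc m} χ∼δ (χ^∼ m)
    (λ k → ≈-trans (*-zero (δ-≢ (m+1+n≢m k))) (≈-sym (*-zero (δ-≢ (m+1+n≢m k)))))
    λ {k} {n} k<n → 0+ (*-zero (δ-≢ (m+1+n≢m k))) (+0 (step k<n)
      (*-zero′ (*-zero (δ-≢ (m+1+n≢m n)))))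
    where
    step : ∀ {k n} → k < n →
      ∑ (between k n) (λ i → ι (F i) * (δ (k + 1) i *
        (δ (i + suc m) n * ι (product (map F (between i n)))))) ≈
      δ (k + suc (suc m)) n * ι (product (map F (between k n)))
    step {k} {n} k<n with m≤n⇒m<n∨m≡n k<n
    -- With `n = k + 1` no intermediate rank exists, and the right side is zero because the exponent
    -- is at least 2.
    ... | inj₂ refl rewrite between-[] {k} {suc k} ≤-refl =
      ≈-sym (*-zero (δ-≢ λ eq → m+1+n≢m k (suc-injective (trans (sym (+-suc k (suc m))) eq))))
    ... | inj₁ 1+k<n rewrite between-∷ 1+k<n = begin
      ι (F (suc k)) * (δ (k + 1) (suc k) * (δ (suc k + suc m) n * ι p)) +ᴿ
        ∑ (between (suc k) n) _
        ≈⟨ +0 (*-congˡ (1* (δ-≡ (+-comm k 1)) ≈-refl))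
              (∑-zero (between (suc k) n) λ i∈ → *-zero′ (*-zero (δ-≢ λ k+1≡i →
                <⇒≢ (proj₁ (∈-between⁻ {suc k} {n} i∈)) (trans (+-comm 1 k) k+1≡i)))) ⟩
      ι (F (suc k)) * (δ (suc k + suc m) n * ι p)    ≈⟨ *-assoc _ _ _ ⟨
      ι (F (suc k)) * δ (suc k + suc m) n * ι p      ≈⟨ *-congʳ (ι-*-central (F (suc k)) _) ⟩
      δ (suc k + suc m) n * ι (F (suc k)) * ι p      ≈⟨ *-assoc _ _ _ ⟩
      δ (suc k + suc m) n * (ι (F (suc k)) * ι p)    ≈⟨ *-congˡ (ι-* (F (suc k)) p) ⟨
      δ (suc k + suc m) n * ι (F (suc k) ℕ.* p)
        ≡⟨ cong (λ j → δ j n * ι (F (suc k) ℕ.* p)) (sym (+-suc k (suc m))) ⟩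
      δ (k + suc (suc m)) n * ι (F (suc k) ℕ.* p)    ∎
      where p = product (map F (between (suc k) n))

  -- The Möbius function and the uniqueness of the inverse of `ζ`.

  sign : ℕ → Carrier
  sign m = (- 1#) ^ᴿ m

  sign-suc : ∀ m → sign (suc m) ≈ - sign m
  sign-suc m = -1*x≈-x (sign m)

  -- Needed in `M-∷`, where a factor split off at the lower end has to pass in front of the sign.
  sign-central : ∀ m a → a * sign m ≈ sign m * a
  sign-central zero    a = ≈-trans (*-identityʳ a) (≈-sym (*-identityˡ a))
  sign-central (suc m) a = begin
    a * sign (suc m)     ≈⟨ *-congˡ (sign-suc m) ⟩
    a * - sign m         ≈⟨ -‿distribʳ-* a _ ⟨
    - (a * sign m)       ≈⟨ -‿cong (sign-central m a) ⟩
    - (sign m * a)       ≈⟨ -‿distribˡ-* _ a ⟩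
    - sign m * a         ≈⟨ *-congʳ (sign-suc m) ⟨
    sign (suc m) * a     ∎

  ∏-∷ʳ : ∀ (xs : List A) x g → ∏ (xs ∷ʳ x) g ≈ ∏ xs g * g x
  ∏-∷ʳ []       x g = ≈-trans (*-identityʳ _) (≈-sym (*-identityˡ _))
  ∏-∷ʳ (y ∷ xs) x g = ≈-trans (*-congˡ (∏-∷ʳ xs x g)) (≈-sym (*-assoc _ _ _))

  factor : ℕ → Carrier
  factor i = ι (F i) - 1#

  M : ℕ → ℕ → Carrier
  M k n = sign (n ∸ k) * ∏ (between k n) factor

  M-≡ : ∀ {k n e is} → n ∸ k ≡ e → between k n ≡ is → M k n ≡ sign e * ∏ is factor
  M-≡ = cong₂ (λ e is → sign e * ∏ is factor)

  M-diag : ∀ k → M k k ≈ 1#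
  M-diag k = ≈-trans (≈-reflexive (M-≡ {k} (n∸n≡0 k) (between-[] {k} (n≤1+n k))))
    (*-identityˡ 1#)

  M-adjacent : ∀ k → M k (suc k) ≈ - 1#
  M-adjacent k = ≈-trans (≈-reflexive (M-≡ {k} (m+n∸n≡m 1 k) (between-[] {k} ≤-refl)))
    (*1 (*-identityʳ _) ≈-refl)

  -- At `k = n` the range would stay empty and only the sign would change; that step is
  -- `M-adjacent`.
  M-∷ʳ : ∀ {k n} → k < n → M k (suc n) ≈ - (M k n * factor n)
  M-∷ʳ {k} {n} k<n = begin
    M k (suc n)        ≡⟨ M-≡ {k} (+-∸-assoc 1 (<⇒≤ k<n)) (between-∷ʳ k<n) ⟩
    sign (suc (n ∸ k)) * ∏ (between k n ∷ʳ n) factor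
      ≈⟨ *-cong (sign-suc (n ∸ k)) (∏-∷ʳ (between k n) n factor) ⟩
    - sign (n ∸ k) * (∏ (between k n) factor * factor n)     ≈⟨ -‿distribˡ-* _ _ ⟨
    - (sign (n ∸ k) * (∏ (between k n) factor * factor n))   ≈⟨ -‿cong (*-assoc _ _ _) ⟨
    - (M k n * factor n)                                     ∎

  M-∷ : ∀ {k n} → suc k < n → M k n ≈ - (factor (suc k) * M (suc k) n)
  M-∷ {k} {n} 1+k<n = begin
    M k n              ≡⟨ M-≡ {k} (+-∸-assoc 1 (<⇒≤ 1+k<n)) (between-∷ 1+k<n) ⟩
    sign (suc e) * (factor (suc k) * p)        ≈⟨ *-congʳ (sign-suc e) ⟩
    - sign e * (factor (suc k) * p)            ≈⟨ -‿distribˡ-* _ _ ⟨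
    - (sign e * (factor (suc k) * p))          ≈⟨ -‿cong (*-assoc _ _ _) ⟨
    - (sign e * factor (suc k) * p)            ≈⟨ -‿cong (*-congʳ (sign-central e _)) ⟨
    - (factor (suc k) * sign e * p)            ≈⟨ -‿cong (*-assoc _ _ _) ⟩
    - (factor (suc k) * (sign e * p))          ∎
    where
    e = n ∸ suc k
    p = ∏ (between (suc k) n) factor

  -- Induction on the upper end, the leading `1#` standing for `M k k`: adding the term at `n` to
  -- `- M k n` gives `M k n * factor n`, which is `- M k (suc n)` by `M-∷ʳ`.
  ∑-M-right : ∀ {k n} → k < n → 1# +ᴿ ∑ (between k n) (λ i → ι (F i) * M k i) ≈ - M k n
  ∑-M-right {k} k<n = go (≤⇒≤′ k<n)
    where
    term : ℕ → Carrier
    term i = ι (F i) * M k i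
    go : ∀ {n} → suc k ≤′ n → 1# +ᴿ ∑ (between k n) term ≈ - M k n
    go (≤′-reflexive refl) = begin
      1# +ᴿ ∑ (between k (suc k)) term
        ≡⟨ cong (λ is → 1# +ᴿ ∑ is term) (between-[] {k} ≤-refl) ⟩
      1# +ᴿ 0#          ≈⟨ +-identityʳ 1# ⟩
      1#                ≈⟨ -‿involutive 1# ⟨
      - - 1#            ≈⟨ -‿cong (M-adjacent k) ⟨
      - M k (suc k)     ∎
    go {suc n} (≤′-step k<′n) = begin
      1# +ᴿ ∑ (between k (suc n)) term
        ≡⟨ cong (λ is → 1# +ᴿ ∑ is term) (between-∷ʳ k<n′) ⟩
      1# +ᴿ ∑ (between k n ∷ʳ n) term           ≈⟨ +-congˡ (∑-++ (between k n) (n ∷ []) term) ⟩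
      1# +ᴿ (∑ (between k n) term +ᴿ (term n +ᴿ 0#))   ≈⟨ +-assoc _ _ _ ⟨
      1# +ᴿ ∑ (between k n) term +ᴿ (term n +ᴿ 0#)     ≈⟨ +-cong (go k<′n) (+-identityʳ _) ⟩
      - M k n +ᴿ ι (F n) * M k n                ≈⟨ +ᴿ-comm _ _ ⟩
      ι (F n) * M k n - M k n
        ≈⟨ +-cong (ι-*-central (F n) _) (-‿cong (≈-sym (*-identityʳ _))) ⟩
      M k n * ι (F n) - M k n * 1#              ≈⟨ x[y-z]≈xy-xz _ _ _ ⟨
      M k n * factor n                    ≈⟨ -‿involutive _ ⟨
      - - (M k n * factor n)              ≈⟨ -‿cong (M-∷ʳ k<n′) ⟨
      - M k (suc n)                             ∎
      where k<n′ = ≤′⇒≤ k<′n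

  -- The mirror image, with `1#` standing for `M n n`. The lower end now moves, which is why `≤‴`
  -- replaces `≤′`.
  ∑-M-left : ∀ {k n} → k < n → ∑ (between k n) (λ i → ι (F i) * M i n) +ᴿ 1# ≈ - M k n
  ∑-M-left {n = n} k<n = go (≤⇒≤‴ k<n)
    where
    term : ℕ → Carrier
    term i = ι (F i) * M i n
    go : ∀ {k} → suc k ≤‴ n → ∑ (between k n) term +ᴿ 1# ≈ - M k n
    go {k} (≤‴-reflexive refl) = begin
      ∑ (between k (suc k)) term +ᴿ 1#
        ≡⟨ cong (λ is → ∑ is term +ᴿ 1#) (between-[] {k} ≤-refl) ⟩
      0# +ᴿ 1#          ≈⟨ +-identityˡ 1# ⟩
      1#                ≈⟨ -‿involutive 1# ⟨
      - - 1#            ≈⟨ -‿cong (M-adjacent k) ⟨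
      - M k (suc k)     ∎
    go {k} (≤‴-step 1+k<‴n) = begin
      ∑ (between k n) term +ᴿ 1#
        ≡⟨ cong (λ is → ∑ is term +ᴿ 1#) (between-∷ 1+k<n) ⟩
      (term (suc k) +ᴿ ∑ (between (suc k) n) term) +ᴿ 1#   ≈⟨ +-assoc _ _ _ ⟩
      term (suc k) +ᴿ (∑ (between (suc k) n) term +ᴿ 1#)   ≈⟨ +-congˡ (go 1+k<‴n) ⟩
      ι (F (suc k)) * M (suc k) n - M (suc k) n
        ≈⟨ +-congˡ (-‿cong (≈-sym (*-identityˡ _))) ⟩
      ι (F (suc k)) * M (suc k) n - 1# * M (suc k) n   ≈⟨ [y-z]x≈yx-zx _ _ _ ⟨
      factor (suc k) * M (suc k) n               ≈⟨ -‿involutive _ ⟨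
      - - (factor (suc k) * M (suc k) n)         ≈⟨ -‿cong (M-∷ 1+k<n) ⟨
      - M k n                                          ∎
      where 1+k<n = ≤‴⇒≤ 1+k<‴n

  -- `M` alone is not an element of the incidence algebra: its value is 1 when `k > n`, and also at
  -- two distinct vertices of one level. The restriction to `≼` cuts these off.
  𝝁 : I
  ⟦ 𝝁 ⟧ x y = restrict (x ≼? y) (M (r x) (r y))
  vanishes 𝝁 {x} {y} = restrict-false (x ≼? y)

  𝝁∼M : 𝝁 ∼ M
  𝝁∼M x y = restrict-true (x ≼? y)

  𝝁∗ζ≋𝜹 : 𝝁 ∗ ζ ≋ 𝜹
  𝝁∗ζ≋𝜹 = ∼⇒≋ {𝝁 ∗ ζ} {𝜹} (∗-∼ {𝝁} {ζ} 𝝁∼M ζ∼1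
    (λ k → ≈-trans (*1 (M-diag k) ≈-refl) (≈-sym (δ-≡ {k} refl)))
    λ {k} {n} k<n → begin
      M k k * 1# +ᴿ (∑ (between k n) (λ i → ι (F i) * (M k i * 1#)) +ᴿ M k n * 1#)
        ≈⟨ +-cong (*1 (M-diag k) ≈-refl)
             (+-cong (∑-cong (between k n) λ _ → *-congˡ (*-identityʳ _)) (*-identityʳ _)) ⟩
      1# +ᴿ (∑ (between k n) (λ i → ι (F i) * M k i) +ᴿ M k n)   ≈⟨ +-assoc _ _ _ ⟨
      1# +ᴿ ∑ (between k n) (λ i → ι (F i) * M k i) +ᴿ M k n     ≈⟨ +-congʳ (∑-M-right k<n) ⟩
      - M k n +ᴿ M k n                                           ≈⟨ -‿inverseˡ _ ⟩
      0#                                                         ≈⟨ δ-≢ (<⇒≢ k<n) ⟨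
      δ k n                                                      ∎) 𝜹∼δ

  ζ∗𝝁≋𝜹 : ζ ∗ 𝝁 ≋ 𝜹
  ζ∗𝝁≋𝜹 = ∼⇒≋ {ζ ∗ 𝝁} {𝜹} (∗-∼ {ζ} {𝝁} ζ∼1 𝝁∼M
    (λ k → ≈-trans (1* ≈-refl (M-diag k)) (≈-sym (δ-≡ {k} refl)))
    λ {k} {n} k<n → begin
      1# * M k n +ᴿ (∑ (between k n) (λ i → ι (F i) * (1# * M i n)) +ᴿ 1# * M n n)
        ≈⟨ +-cong (*-identityˡ _)
             (+-cong (∑-cong (between k n) λ _ → *-congˡ (*-identityˡ _)) (1* ≈-refl (M-diag n))) ⟩
      M k n +ᴿ (∑ (between k n) (λ i → ι (F i) * M i n) +ᴿ 1#)   ≈⟨ +-congˡ (∑-M-left k<n) ⟩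
      M k n - M k n                                              ≈⟨ -‿inverseʳ _ ⟩
      0#                                                         ≈⟨ δ-≢ (<⇒≢ k<n) ⟨
      δ k n                                                      ∎) 𝜹∼δ

  -- With `x` fixed, the last term of `f ∗ ζ` at `y` is the value of `f` at `y` itself, and all
  -- other terms involve only right endpoints of smaller rank. This gives uniqueness without appeal
  -- to associativity of `∗`.
  ζ-cancelʳ : ∀ {f g} → f ∗ ζ ≋ g ∗ ζ → f ≋ g
  ζ-cancelʳ {f} {g} f∗ζ≋g∗ζ x y with x ≼? y
  ... | no  x⋠y = ≈-trans (vanishes f x⋠y) (≈-sym (vanishes g x⋠y))
  ... | yes x≼y = go y (<-wellFounded (r y)) x≼y
    where
    *ζ : ∀ h z → x ≼ z → ⟦ h ⟧ x z * ⟦ ζ ⟧ z z ≈ ⟦ h ⟧ x z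
    *ζ h z _ = *1 ≈-refl (ζ∼1 z z (≼-reflexive {z} refl))

    go : ∀ y → Acc _<_ (r y) → x ≼ y → ⟦ f ⟧ x y ≈ ⟦ g ⟧ x y
    go y (acc rec) x≼y with m≤n⇒m<n∨m≡n (≼⇒r≤r {x} {y} x≼y)
    ... | inj₂ k≡n with refl ← same-rank {x} {y} x≼y k≡n = begin
      ⟦ f ⟧ x x                  ≈⟨ *ζ f x x≼y ⟨
      ⟦ f ⟧ x x * ⟦ ζ ⟧ x x      ≈⟨ ∑-segment-≡ x x _ x≼y refl ⟨
      ⟦ f ∗ ζ ⟧ x x              ≈⟨ f∗ζ≋g∗ζ x x ⟩
      ⟦ g ∗ ζ ⟧ x x              ≈⟨ ∑-segment-≡ x x _ x≼y refl ⟩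
      ⟦ g ⟧ x x * ⟦ ζ ⟧ x x      ≈⟨ *ζ g x x≼y ⟩
      ⟦ g ⟧ x x                  ∎
    -- By recursion the terms at `x` and on the inner levels agree for `f` and `g`, so they cancel.
    ... | inj₁ k<n = +-cancelˡ (inner g) _ _ (+-cancelˡ (first g) _ _ (begin
      first g +ᴿ (inner g +ᴿ ⟦ f ⟧ x y)
        ≈⟨ +-cong first≈ (+-cong inner≈ (*ζ f y x≼y)) ⟨
      first f +ᴿ (inner f +ᴿ ⟦ f ⟧ x y * ⟦ ζ ⟧ y y)     ≈⟨ ∑-segment-< x y _ k<n ⟨
      ⟦ f ∗ ζ ⟧ x y                                     ≈⟨ f∗ζ≋g∗ζ x y ⟩
      ⟦ g ∗ ζ ⟧ x y                                     ≈⟨ ∑-segment-< x y _ k<n ⟩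
      first g +ᴿ (inner g +ᴿ ⟦ g ⟧ x y * ⟦ ζ ⟧ y y)     ≈⟨ +-congˡ (+-congˡ (*ζ g y x≼y)) ⟩
      first g +ᴿ (inner g +ᴿ ⟦ g ⟧ x y)                 ∎))
      where
      first inner : I → Carrier
      first h = ⟦ h ⟧ x x * ⟦ ζ ⟧ x y
      inner h = ∑ (between (r x) (r y)) λ i → ∑ (level i) λ z → ⟦ h ⟧ x z * ⟦ ζ ⟧ z y
      first≈ : first f ≈ first g
      first≈ = *-congʳ (go x (rec k<n) (≼-reflexive {x} refl))
      inner≈ : inner f ≈ inner g
      inner≈ = ∑-cong (between (r x) (r y)) λ {i} i∈ → ∑-cong (level i) λ { z∈ → on i∈ z∈ }
        where
        on : ∀ {i z} → i ∈ between (r x) (r y) → z ∈ level i →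
          ⟦ f ⟧ x z * ⟦ ζ ⟧ z y ≈ ⟦ g ⟧ x z * ⟦ ζ ⟧ z y
        on {i} i∈ z∈ with j , _ , refl ← ∈-map⁻ (i ,_) z∈ =
          let k<i , i<n = ∈-between⁻ i∈ in *-congʳ (go (i , j) (rec i<n) (inj₁ k<i))

  -- Any inverse and `𝝁` have the same product with `ζ`, namely `𝜹`, and `ζ` can be cancelled.
  inverse∼M : (ζ⁻¹ : Invertible 𝜹 _∗_ ζ) → proj₁ ζ⁻¹ ∼ M
  inverse∼M (μ , μ∗ζ≋𝜹 , _) x y x≼y = ≈-trans
    (ζ-cancelʳ {μ} {𝝁} (λ u v → ≈-trans (μ∗ζ≋𝜹 u v) (≈-sym (𝝁∗ζ≋𝜹 u v))) x y)
    (𝝁∼M x y x≼y)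

  -- The formula for `η ^ 2`: a chain with one entry is a single rank `i`, and its empty remainder
  -- has weight 1 because `i < n`.
  ι-chainWeight-1 : ∀ k n → ι (chainWeight F 1 k n) ≈ ι (sum (map F (between k n)))
  ι-chainWeight-1 k n = begin
    ι (chainWeight F 1 k n)                           ≡⟨ cong ι (chainWeight-suc F 0 k n) ⟩
    ι (sum (map (λ i → F i ℕ.* chainWeight F 0 i n) (between k n)))
      ≈⟨ ι-sum _ (between k n) ⟩
    ∑ (between k n) (λ i → ι (F i ℕ.* chainWeight F 0 i n))
      ≈⟨ ∑-cong (between k n) (λ {i} i∈ → ≈-reflexive (cong ι (trans
           (cong (F i ℕ.*_) (chainWeight-0-< F (proj₂ (∈-between⁻ {k} {n} i∈))))
           (ℕₚ.*-identityʳ (F i))))) ⟩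
    ∑ (between k n) (λ i → ι (F i))                   ≈⟨ ι-sum F (between k n) ⟨
    ι (sum (map F (between k n)))                     ∎

corollary1 : ∀ {c ℓ : Level} (R : Ring c ℓ) (F : ℕ → ℕ) → Designating F →
    let open Incidence F R in
    Invertible 𝜹 _∗_ ζ ×
    (∀ (k n s : ℕ) → s ≥ 1 →
    ((k ≤ n → ζ ⟨ k ∣ n ⟩≈ 1#) × (k > n → ζ ⟨ k ∣ n ⟩≈ 0#))
    ×
    ((k < n → (ζ ^ 2) ⟨ k ∣ n ⟩≈ ι (sum (map F (between k n)) + 2)) ×
    (k ≡ n → (ζ ^ 2) ⟨ k ∣ n ⟩≈ 1#) ×
    (k > n → (ζ ^ 2) ⟨ k ∣ n ⟩≈ 0#))
    ×
    ((k < n → η ⟨ k ∣ n ⟩≈ 1#) × (k ≥ n → η ⟨ k ∣ n ⟩≈ 0#))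
    ×
    ((k ≤ n → (η ^ 2) ⟨ k ∣ n ⟩≈ ι (sum (map F (between k n)))) ×
    (k > n → (η ^ 2) ⟨ k ∣ n ⟩≈ 0#))
    ×
    ((k ≤ n → (η ^ s) ⟨ k ∣ n ⟩≈
    ι (sum (map (λ is → product (map F is)) (chains (s ∸ 1) k n)))) ×
    (k > n → (η ^ s) ⟨ k ∣ n ⟩≈ 0#))
    ×
    ((k ≡ n → 𝒞 ⟨ k ∣ n ⟩≈ 1#) ×
    (k < n → 𝒞 ⟨ k ∣ n ⟩≈ (- 1#)) ×
    (k > n → 𝒞 ⟨ k ∣ n ⟩≈ 0#))
    ×
    (χ ⟨ k ∣ n ⟩≈ δ (k + 1) n)
    ×
    ((χ ^ s) ⟨ k ∣ n ⟩≈ (δ (k + s) n * ι (product (map F (between k n)))))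
    ×
    (∀ (ζ⁻¹ : Invertible 𝜹 _∗_ ζ) → let μ = proj₁ ζ⁻¹ in
    (k ≤ n → μ ⟨ k ∣ n ⟩≈
    ((- 1#) ^ᴿ (n ∸ k) * ∏ (between k n) (λ i → ι (F i) - 1#))) ×
    (k > n → μ ⟨ k ∣ n ⟩≈ 0#)))
corollary1 R F _ = (𝝁 , 𝝁∗ζ≋𝜹 , ζ∗𝝁≋𝜹) , λ { k n (suc m) _ →
    ((λ k≤n → ∼⇒⟨⟩-≤ {ζ} ζ∼1 k≤n ≈-refl) , ⟨⟩-> ζ) ,
    ( (λ k<n → (λ { x y _ refl refl → ≈-trans
          (∗-< {ζ} {ζ ∗ 𝜹} ζ∼1 (∗-𝜹 {ζ} ζ∼1) x y k<n) (convolve-1-1 k n) }) ,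
        λ k>n → contradiction k<n (<⇒≯ k>n)) ,
      -- At `k = n` the segment is a single vertex, so the value is 1; the 2 counts two distinct
      -- endpoints.
      (λ { refl → (λ { x y x≼y refl ry≡k → ≈-trans
          (∗-≡ {ζ} {ζ ∗ 𝜹} ζ∼1 (∗-𝜹 {ζ} ζ∼1) x y x≼y (sym ry≡k)) (*-identityˡ 1#) }) ,
        λ k>k → contradiction k>k (<-irrefl refl) }) ,
      ⟨⟩-> (ζ ^ 2) ) ,
    ( (λ k<n → ∼⇒⟨⟩-≤ {η} η∼lt (<⇒≤ k<n) (lt-< k<n)) ,
      λ k≥n → ∼⇒⟨⟩ {η} η∼lt (lt-≥ k≥n) λ _ → ≈-refl ) ,
    ((λ k≤n → ∼⇒⟨⟩-≤ {η ^ 2} (η^∼ 1) k≤n (ι-chainWeight-1 k n)) , ⟨⟩-> (η ^ 2)) ,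
    ((λ k≤n → ∼⇒⟨⟩-≤ {η ^ suc m} (η^∼ m) k≤n ≈-refl) , ⟨⟩-> (η ^ suc m)) ,
    ( (λ { refl → ∼⇒⟨⟩-≤ {𝒞} 𝒞∼δ-lt ≤-refl (≈-trans
          (+-cong (δ-≡ {k} refl) (-‿cong (lt-≥ {k} ≤-refl))) (x-0≈x 1#)) }) ,
      (λ k<n → ∼⇒⟨⟩-≤ {𝒞} 𝒞∼δ-lt (<⇒≤ k<n)
          (0+ (δ-≢ (<⇒≢ k<n)) (-‿cong (lt-< k<n)))) ,
      ⟨⟩-> 𝒞 ) ,
    -- The formulas for `χ` and its powers have no case split, so for `k > n` the factor `δ` itself
    -- has to supply the zero.
    ∼⇒⟨⟩ {χ} χ∼δ ≈-refl (λ k>n → δ-≢ (k+1+m≢n 0 k>n)) ,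
    ∼⇒⟨⟩ {χ ^ suc m} (χ^∼ m) ≈-refl (λ k>n → *-zero (δ-≢ (k+1+m≢n m k>n))) ,
    λ ζ⁻¹ → (λ k≤n → ∼⇒⟨⟩-≤ {proj₁ ζ⁻¹} (inverse∼M ζ⁻¹) k≤n ≈-refl) , ⟨⟩-> (proj₁ ζ⁻¹) }
  where
  open Incidence F R
  open RankFunctions R F
  open Ring R using (+-cong; -‿cong; *-identityˡ) renaming (refl to ≈-refl; trans to ≈-trans)
  k+1+m≢n : ∀ {k n} m → k > n → k + suc m ≢ n
  k+1+m≢n {k} m k>n refl = <⇒≱ k>n (m≤m+n k (suc m))
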